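{- Let $S$ be the unique formal power series in the variables $t_1,t_2,\dots$ satisfying $S=1+\sum_{n=1}^\infty t_nS^n$. Then $S$ is the generating function for excursions, i.e. $S=\sum_{P}w(P)$, where the sum is over all excursions $P$ with steps in $\{ -1,0,1,2,\dots\}$ and $w(P)$ is the weight of $P$.
   Context: A path is a finite (possibly empty) sequence $(s_1,\dots,s_k)$ of integers, called its steps; here all steps are in $\{ -1,0,1,2,\dots\}$. An excursion is a path (possibly empty) such that every partial sum $s_1+\cdots+s_i$ ($0\le i\le k$) is nonnegative and the total sum $s_1+\cdots+s_k$ is $0$. The weight of a step $n\ge 0$ is $t_{n+1}$, the weight of the step $-1$ is $1$, and the weight $w(P)$ of a path $P$ is the product of the weights of its steps (the empty path has weight $1$). The generating function for a set of paths is the sum of their weights, as a formal power series in the infinitely many commuting variables $t_1,t_2,\dots$ (arbitrary formal, possibly infinite, linear combinations of monomials). -}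

module Defs where

open import Level using (Level; _⊔_)
open import Algebra.Bundles using (CommutativeRing; RawSemiring)
open import Data.Fin.Base using (toℕ)
open import Data.Integer.Base as ℤ using (ℤ; +_; -1ℤ; 0ℤ)
open import Data.List.Base using (List; []; _∷_; _∷ʳ_; foldr; map; length; take)
open import Data.List.Membership.Propositional using (_∉_)
open import Data.List.Relation.Unary.All using (All)
open import Data.List.Relation.Unary.Unique.Propositional using (Unique)
open import Data.Nat.Base using (ℕ; zero; suc; _∸_; _≤_)
open import Data.Product.Base using (∃-syntax; _×_)
open import Function.Base using (_∘_)
open import Relation.Binary.PropositionalEquality.Core using (_≡_)
open import Relation.Unary using (Pred; U)

data Step : Set where
  down : Step
  up   : ℕ → Step

⟦_⟧ : Step → ℤ
⟦ down ⟧ = -1ℤ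
⟦ up n ⟧ = + n

Path : Set
Path = List Step

total : Path → ℤ
total p = foldr ℤ._+_ 0ℤ (map ⟦_⟧ p)

record IsExcursion (p : Path) : Set where
  field
    partial≥0 : ∀ i → i ≤ length p → 0ℤ ℤ.≤ total (take i p)
    total≡0   : total p ≡ 0ℤ

-- The list e₁ ∷ e₂ ∷ … ∷ e_k ∷ [] stands for the monomial t₁^e₁ t₂^e₂ ⋯ t_k^e_k,
-- so two lists name the same monomial exactly when they differ by trailing zeros.
Exponents : Set
Exponents = List ℕ

-- Formal power series in t₁, t₂, … with coefficients in an arbitrary commutative ring.
module PowerSeries {c ℓ : Level} (R : CommutativeRing c ℓ) where

  private module R = CommutativeRing R
  open import Algebra.Properties.CommutativeMonoid.Sum R.+-commutativeMonoid
    using (sum; sum-cong-≋)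

  Respects : (Exponents → R.Carrier) → Set ℓ
  Respects f = ∀ m → f (m ∷ʳ 0) R.≈ f m

  record Series : Set (c ⊔ ℓ) where
    constructor series
    field
      coeff    : Exponents → R.Carrier
      respects : Respects coeff
  open Series public

  infix 4 _≈_
  _≈_ : Series → Series → Set ℓ
  f ≈ g = ∀ m → coeff f m R.≈ coeff g m

  zeroCoeff : Exponents → R.Carrier
  zeroCoeff _ = R.0#

  oneCoeff : Exponents → R.Carrier
  oneCoeff []          = R.1#
  oneCoeff (zero  ∷ m) = oneCoeff m
  oneCoeff (suc _ ∷ _) = R.0#

  varCoeff : ℕ → Exponents → R.Carrier
  varCoeff _       []                = R.0#
  varCoeff zero    (zero ∷ _)        = R.0#
  varCoeff zero    (suc zero ∷ m)    = oneCoeff m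
  varCoeff zero    (suc (suc _) ∷ _) = R.0#
  varCoeff (suc n) (zero ∷ m)        = varCoeff n m
  varCoeff (suc n) (suc _ ∷ _)       = R.0#

  -- The sum of f a · g b over all factorisations of m as a product of monomials a · b,
  -- enumerated one exponent at a time.
  convolve : (f g : Exponents → R.Carrier) → Exponents → R.Carrier
  convolve f g []      = f [] R.* g []
  convolve f g (e ∷ m) =
    sum {suc e} λ i → convolve (f ∘ (toℕ i ∷_)) (g ∘ (e ∸ toℕ i ∷_)) m

  oneCoeff-respects : Respects oneCoeff
  oneCoeff-respects []          = R.refl
  oneCoeff-respects (zero  ∷ m) = oneCoeff-respects m
  oneCoeff-respects (suc _ ∷ m) = R.refl

  varCoeff-respects : ∀ n → Respects (varCoeff n)
  varCoeff-respects zero    []                = R.refl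
  varCoeff-respects (suc n) []                = R.refl
  varCoeff-respects zero    (zero ∷ m)        = R.refl
  varCoeff-respects zero    (suc zero ∷ m)    = oneCoeff-respects m
  varCoeff-respects zero    (suc (suc _) ∷ m) = R.refl
  varCoeff-respects (suc n) (zero ∷ m)        = varCoeff-respects n m
  varCoeff-respects (suc n) (suc _ ∷ m)       = R.refl

  convolve-respects : ∀ {f g} → Respects f → Respects g → Respects (convolve f g)
  convolve-respects f-resp g-resp []      =
    R.trans (R.+-identityʳ _) (R.*-cong (f-resp []) (g-resp []))
  convolve-respects f-resp g-resp (e ∷ m) = sum-cong-≋ {suc e} λ i →
    convolve-respects (f-resp ∘ (toℕ i ∷_)) (g-resp ∘ (e ∸ toℕ i ∷_)) m

  rawSemiring : RawSemiring (c ⊔ ℓ) ℓ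
  rawSemiring = record
    { Carrier = Series
    ; _≈_     = _≈_
    ; _+_     = λ f g → series (λ m → coeff f m R.+ coeff g m)
                               (λ m → R.+-cong (respects f m) (respects g m))
    ; _*_     = λ f g → series (convolve (coeff f) (coeff g))
                               (convolve-respects (respects f) (respects g))
    ; 0#      = series zeroCoeff (λ _ → R.refl)
    ; 1#      = series oneCoeff oneCoeff-respects
    }

  open RawSemiring rawSemiring public using (_+_; _*_; 0#; 1#)
  open import Algebra.Definitions.RawSemiring rawSemiring public using (_^_)

  -- The variable t_{n+1}.
  t[1+_] : ℕ → Series
  t[1+ n ] = series (varCoeff n) (varCoeff-respects n)

  -- s is the sum of the possibly infinite family (f i), i ranging over A: for each
  -- monomial only finitely many members contribute, and their coefficients add up to
  -- that of s.
  HasSum : ∀ {a p} {I : Set a} → Pred I p → (I → Series) → Series → Set (a ⊔ p ⊔ ℓ)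
  HasSum {I = I} A f s = ∀ m → ∃[ is ]
    ( Unique is
    × All A is
    × (∀ i → A i → i ∉ is → coeff (f i) m R.≈ R.0#)
    × coeff s m R.≈ foldr R._+_ R.0# (map (λ i → coeff (f i) m) is) )

  stepWeight : Step → Series
  stepWeight down   = 1#
  stepWeight (up n) = t[1+ n ]

  weight : Path → Series
  weight p = foldr _*_ 1# (map stepWeight p)

  IsGeneratingFunction : ∀ {p} → Pred Path p → Series → Set (p ⊔ ℓ)
  IsGeneratingFunction A = HasSum A weight

  -- s = 1 + Σ_{n ≥ 1} tₙ sⁿ, with the summation index shifted down by one.
  Equation : Series → Set (c ⊔ ℓ)
  Equation s = ∃[ r ] (HasSum U (λ n → t[1+ n ] * s ^ suc n) r × s ≈ 1# + r)

{-# OPTIONS --safe #-}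

-- Let G h be the generating function of the nonnegative paths from height h to height 0.
-- Splitting off the first step gives
--   G h = G (h - 1) + Σ_{n ≥ 0} t_{n+1} G (h + n),   with G (-1) read as 1,
-- which determines all coefficients, since a path of given weight and starting height has a
-- given length. This recursion yields G g · G h = G (g + h + 1) by induction on the length,
-- hence G n = (G 0)^{n+1}, and the case h = 0 says that G 0 solves the equation for S. The
-- solution is unique because a coefficient of t_{n+1} S^{n+1} involves only coefficients of S
-- at smaller monomials.
module Submission where

open import Defs
open import Algebra.Bundles using (CommutativeRing)
open import Data.Empty using (⊥-elim)
open import Data.Fin.Base using (toℕ)
open import Data.Fin.Properties using (toℕ≤pred[n])
open import Data.Integer.Base as ℤ using (+_; 0ℤ)
import Data.Integer.Properties as ℤ
open import Data.List.Base
  using (List; []; _∷_; _∷ʳ_; _++_; foldr; map; concatMap; length; take; upTo; filter)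
open import Data.List.Membership.Propositional using (_∈_; _∉_; lose; find)
open import Data.List.Membership.Propositional.Properties
  using (∈-++⁺ˡ; ∈-++⁺ʳ; ∈-map⁺; ∈-map⁻; ∈-concatMap⁺; ∈-concatMap⁻; ∈-upTo⁺; ∈-filter⁺; ∈-filter⁻)
open import Data.List.Membership.Propositional.Properties.WithK using (unique∧set⇒bag)
open import Data.List.Properties using (map-∘)
import Data.List.Membership.DecPropositional as DecMembership
open import Data.List.Relation.Binary.BagAndSetEquality using (∼bag⇒↭)
open import Data.List.Relation.Binary.Permutation.Propositional using (_↭_; ↭⇒↭ₛ′)
import Data.List.Relation.Binary.Permutation.Propositional.Properties as ↭
import Data.List.Relation.Binary.Permutation.Setoid.Properties as ↭ₛ
open import Data.List.Relation.Binary.Pointwise as Pointwise using (Pointwise; []; _∷_; Pointwise-length)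
open import Data.List.Relation.Unary.All as All using (All; []; _∷_)
import Data.List.Relation.Unary.All.Properties as All
open import Data.List.Relation.Unary.AllPairs using ([]; _∷_)
open import Data.List.Relation.Unary.Any using (here)
open import Data.List.Relation.Unary.Unique.Propositional using (Unique)
import Data.List.Relation.Unary.Unique.Propositional.Properties as Unique
open import Data.Maybe.Base as Maybe using (Maybe; just; nothing; maybe)
open import Data.Maybe.Properties using (maybe′-map)
open import Data.Nat.Base as ℕ using (ℕ; zero; suc; _≤_; _<_; z≤n; s≤s)
import Data.Nat.Properties as ℕ
open import Data.Nat.Solver using (module +-*-Solver)
open import Data.Product.Base using (_×_; _,_; ∃-syntax)
open import Data.Product using (∃!)
open import Data.Unit.Base using (tt)
open import Function.Base using (_∘_)
open import Function.Bundles using (mk⇔)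
open import Level using (Level)
open import Relation.Binary.Core using (Rel)
open import Relation.Binary.Definitions using (DecidableEquality)
open import Relation.Binary.PropositionalEquality as ≡ using (_≡_)
open import Relation.Nullary.Decidable using (yes; no)
open import Relation.Nullary.Negation using (¬_)
open import Relation.Unary using (Pred; Decidable; U)

private
  variable
    a b p : Level
    A : Set a
    B : Set b

-- Monomials

-- lower n m is the monomial m / t_{n+1}, if t_{n+1} divides m.
lower : ℕ → Exponents → Maybe Exponents
lower _       []          = nothing
lower zero    (zero ∷ _)  = nothing
lower zero    (suc e ∷ m) = just (e ∷ m)
lower (suc n) (e ∷ m)     = Maybe.map (e ∷_) (lower n m)

sizeFrom : ℕ → Exponents → ℕ
sizeFrom k []      = 0
sizeFrom k (e ∷ m) = e ℕ.* k ℕ.+ sizeFrom (suc k) m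

-- The length of the excursions whose weight is the given monomial: a step n, of weight
-- t_{n+1}, is compensated by n steps -1.
size : Exponents → ℕ
size = sizeFrom 1

lower-<length : ∀ n m {m′} → lower n m ≡ just m′ → n < length m
lower-<length zero    (suc e ∷ m) _  = s≤s z≤n
lower-<length (suc n) (e ∷ m)     eq with lower n m in eq′ | eq
... | just _ | ≡.refl = s≤s (lower-<length n m eq′)

-- At a fixed monomial, an infinite sum over `n` can therefore be cut off at the length of the
-- exponent list.
lower-∉upTo : ∀ n m → n ∉ upTo (length m) → lower n m ≡ nothing
lower-∉upTo n m n∉ with lower n m in eq
... | nothing = ≡.refl
... | just _  = ⊥-elim (n∉ (∈-upTo⁺ (lower-<length n m eq)))

lower-∷ʳ : ∀ n m → lower n (m ∷ʳ 0) ≡ Maybe.map (_∷ʳ 0) (lower n m)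
lower-∷ʳ zero    []          = ≡.refl
lower-∷ʳ (suc n) []          = ≡.refl
lower-∷ʳ zero    (zero ∷ m)  = ≡.refl
lower-∷ʳ zero    (suc e ∷ m) = ≡.refl
lower-∷ʳ (suc n) (e ∷ m) rewrite lower-∷ʳ n m with lower n m
... | nothing = ≡.refl
... | just _  = ≡.refl

-- Here `k` is the index of the variable at the head of the list, so position `n` holds the variable
-- of index `k + n`, and dividing by it removes that many steps.
lower-sizeFrom : ∀ k n m {m′} → lower n m ≡ just m′ →
                 sizeFrom k m ≡ k ℕ.+ n ℕ.+ sizeFrom k m′
lower-sizeFrom k zero (suc e ∷ m) ≡.refl =
  solve 3 (λ k x y → (k :+ x) :+ y := (k :+ con 0) :+ (x :+ y)) ≡.refl k (e ℕ.* k) _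
  where open +-*-Solver
lower-sizeFrom k (suc n) (e ∷ m) eq with lower n m in eq′ | eq
... | just m′ | ≡.refl rewrite lower-sizeFrom (suc k) n m eq′ =
  solve 4 (λ k n x y → x :+ (con 1 :+ k :+ n :+ y) := k :+ (con 1 :+ n) :+ (x :+ y))
    ≡.refl k n (e ℕ.* k) (sizeFrom (suc k) m′)
  where open +-*-Solver

-- A path from height `h` to 0 with weight `m` has `h + size m` steps. Removing a first step `up n`
-- leaves a path from `h + n` that is one step shorter; the inductions on length rest on this count.
lower-size : ∀ h n m {m′} → lower n m ≡ just m′ → suc (h ℕ.+ n ℕ.+ size m′) ≡ h ℕ.+ size m
lower-size h n m {m′} eq rewrite lower-sizeFrom 1 n m eq =
  solve 3 (λ h n x → con 1 :+ (h :+ n :+ x) := h :+ (con 1 :+ n :+ x)) ≡.refl h n (size m′)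
  where open +-*-Solver

infix 4 _⊑_
-- Divisibility for monomials written with equally long lists, which is how the factors visited by
-- `convolve` relate to `m`.
_⊑_ : Rel Exponents _
_⊑_ = Pointwise _≤_

⊑-trans : ∀ {l m n} → l ⊑ m → m ⊑ n → l ⊑ n
⊑-trans = Pointwise.transitive ℕ.≤-trans

sizeFrom-mono : ∀ k {l m} → l ⊑ m → sizeFrom k l ≤ sizeFrom k m
sizeFrom-mono k []           = z≤n
sizeFrom-mono k (d≤e ∷ l⊑m) = ℕ.+-mono-≤ (ℕ.*-monoˡ-≤ k d≤e) (sizeFrom-mono (suc k) l⊑m)

-- Paths from a given height down to 0

-- Natural number heights encode nonnegativity: `down` needs a successor, so no partial sum can drop
-- below 0.
data From : ℕ → Path → Set where
  stop : From 0 []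
  down : ∀ {h p} → From h p → From (suc h) (down ∷ p)
  up   : ∀ {h p} n → From (h ℕ.+ n) p → From h (up n ∷ p)

IsExcursionFrom : ℕ → Path → Set
IsExcursionFrom h p =
  (∀ i → i ≤ length p → 0ℤ ℤ.≤ + h ℤ.+ total (take i p)) × + h ℤ.+ total p ≡ 0ℤ

-- Since `+ suc h ℤ.+ ℤ.-1ℤ` computes to `+ h`, reassociating suffices.
suc+down : ∀ h z → + suc h ℤ.+ (ℤ.-1ℤ ℤ.+ z) ≡ + h ℤ.+ z
suc+down h z = ≡.sym (ℤ.+-assoc (+ suc h) ℤ.-1ℤ z)

+up : ∀ h n z → + h ℤ.+ (+ n ℤ.+ z) ≡ + (h ℕ.+ n) ℤ.+ z
+up h n z = ≡.sym (ℤ.+-assoc (+ h) (+ n) z)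

0≤+h+0 : ∀ h → 0ℤ ℤ.≤ + h ℤ.+ 0ℤ
0≤+h+0 h = ℤ.+≤+ z≤n

From⇒IsExcursionFrom : ∀ {h p} → From h p → IsExcursionFrom h p
From⇒IsExcursionFrom stop = (λ { zero _ → 0≤+h+0 0 }) , ≡.refl
From⇒IsExcursionFrom {suc h} {_ ∷ p} (down q) with From⇒IsExcursionFrom q
... | part , tot = part′ , ≡.trans (suc+down h (total p)) tot
  where
  part′ : ∀ i → i ≤ length (down ∷ p) → 0ℤ ℤ.≤ + suc h ℤ.+ total (take i (down ∷ p))
  part′ zero    _         = 0≤+h+0 (suc h)
  part′ (suc i) (s≤s i≤p) = ≡.subst (0ℤ ℤ.≤_) (≡.sym (suc+down h (total (take i p)))) (part i i≤p)
From⇒IsExcursionFrom {h} {_ ∷ p} (up n q) with From⇒IsExcursionFrom q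
... | part , tot = part′ , ≡.trans (+up h n (total p)) tot
  where
  part′ : ∀ i → i ≤ length (up n ∷ p) → 0ℤ ℤ.≤ + h ℤ.+ total (take i (up n ∷ p))
  part′ zero    _         = 0≤+h+0 h
  part′ (suc i) (s≤s i≤p) = ≡.subst (0ℤ ℤ.≤_) (≡.sym (+up h n (total (take i p)))) (part i i≤p)

IsExcursionFrom⇒From : ∀ h p → IsExcursionFrom h p → From h p
IsExcursionFrom⇒From zero    []         _            = stop
-- The partial sum after this step would be -1.
IsExcursionFrom⇒From zero    (down ∷ p) (part , _)   with () ← part 1 (s≤s z≤n)
IsExcursionFrom⇒From (suc h) (down ∷ p) (part , tot) = down (IsExcursionFrom⇒From h p
  ( (λ i i≤p → ≡.subst (0ℤ ℤ.≤_) (suc+down h (total (take i p))) (part (suc i) (s≤s i≤p)))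
  , ≡.trans (≡.sym (suc+down h (total p))) tot))
IsExcursionFrom⇒From h       (up n ∷ p) (part , tot) = up n (IsExcursionFrom⇒From (h ℕ.+ n) p
  ( (λ i i≤p → ≡.subst (0ℤ ℤ.≤_) (+up h n (total (take i p))) (part (suc i) (s≤s i≤p)))
  , ≡.trans (≡.sym (+up h n (total p))) tot))

From⇒IsExcursion : ∀ {p} → From 0 p → IsExcursion p
From⇒IsExcursion {p} q with From⇒IsExcursionFrom q
... | part , tot = record
  { partial≥0 = λ i i≤p → ≡.subst (0ℤ ℤ.≤_) (ℤ.+-identityˡ (total (take i p))) (part i i≤p)
  ; total≡0   = ≡.trans (≡.sym (ℤ.+-identityˡ (total p))) tot
  }

IsExcursion⇒From : ∀ {p} → IsExcursion p → From 0 p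
IsExcursion⇒From {p} ex = IsExcursionFrom⇒From 0 p
  ( (λ i i≤p → ≡.subst (0ℤ ℤ.≤_) (≡.sym (ℤ.+-identityˡ (total (take i p)))) (partial≥0 i i≤p))
  , ≡.trans (ℤ.+-identityˡ (total p)) total≡0)
  where open IsExcursion ex

-- Enumeration of the paths with a given weight

upBlock : ℕ → (Exponents → List Path) → Maybe Exponents → List Path
upBlock n f = maybe (λ m → map (up n ∷_) (f m)) []

-- The paths of length L from height h to height 0 with weight m, provided that
-- L = h + size m.
paths downs ups : (L h : ℕ) → Exponents → List Path
paths zero    h m = [] ∷ []
paths (suc L) h m = downs L h m ++ ups L h m
downs L zero    m = []
downs L (suc h) m = map (down ∷_) (paths L h m)
ups L h m =
  concatMap (λ n → upBlock n (paths L (h ℕ.+ n)) (lower n m)) (upTo (length m))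

∈-upBlock⁻ : ∀ n f x {q} → q ∈ upBlock n f x → ∃[ p ] q ≡ up n ∷ p
∈-upBlock⁻ n f (just m) q∈ with p , _ , q≡ ← ∈-map⁻ _ q∈ = p , q≡

paths-sound : ∀ L h m → h ℕ.+ size m ≡ L → All (From h) (paths L h m)
downs-sound : ∀ L h m → h ℕ.+ size m ≡ suc L → All (From h) (downs L h m)
ups-sound   : ∀ L h m → h ℕ.+ size m ≡ suc L → All (From h) (ups L h m)
-- The length condition excludes positive heights here, so the empty path listed by `paths zero` is
-- correct.
paths-sound zero    zero m eq = stop ∷ []
paths-sound (suc L) h    m eq = All.++⁺ (downs-sound L h m eq) (ups-sound L h m eq)
downs-sound L zero    m eq = []
downs-sound L (suc h) m eq = All.map⁺ (All.map down (paths-sound L h m (ℕ.suc-injective eq)))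
ups-sound L h m eq = All.concat⁺ (All.map⁺ (All.universal block (upTo (length m))))
  where
  block : ∀ n → All (From h) (upBlock n (paths L (h ℕ.+ n)) (lower n m))
  block n with lower n m in eq′
  ... | nothing = []
  ... | just m′ = All.map⁺ (All.map (up n) (paths-sound L (h ℕ.+ n) m′
                    (ℕ.suc-injective (≡.trans (lower-size h n m eq′) eq))))

concatMap-unique : (f : A → List B) → (∀ x → Unique (f x)) →
                   (∀ {x y z} → z ∈ f x → z ∈ f y → x ≡ y) →
                   ∀ {xs} → Unique xs → Unique (concatMap f xs)
concatMap-unique f f! inj []           = []
concatMap-unique f f! inj (x∉xs ∷ xs!) =
  Unique.++⁺ (f! _) (concatMap-unique f f! inj xs!) λ (z∈fx , z∈) →
    let y , y∈xs , z∈fy = find (∈-concatMap⁻ f z∈)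
    in All.lookup x∉xs y∈xs (inj z∈fx z∈fy)

paths-unique : ∀ L h m → Unique (paths L h m)
downs-unique : ∀ L h m → Unique (downs L h m)
ups-unique   : ∀ L h m → Unique (ups L h m)
paths-unique zero    h m = [] ∷ []
paths-unique (suc L) h m =
  Unique.++⁺ (downs-unique L h m) (ups-unique L h m) (disjoint h)
  where
  disjoint : ∀ h′ {q} → ¬ (q ∈ downs L h′ m × q ∈ ups L h m)
  disjoint (suc h′) (q∈downs , q∈ups)
    with _ , _ , ≡.refl ← ∈-map⁻ _ q∈downs
       | n , _ , q∈block ← find (∈-concatMap⁻ (λ n → upBlock n (paths L (h ℕ.+ n)) (lower n m))
                                      {xs = upTo (length m)} q∈ups)
    with () ← ∈-upBlock⁻ n (paths L (h ℕ.+ n)) (lower n m) q∈block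
downs-unique L zero    m = []
downs-unique L (suc h) m = Unique.map⁺ (λ { ≡.refl → ≡.refl }) (paths-unique L h m)
ups-unique L h m = concatMap-unique _ block inj (Unique.upTo⁺ (length m))
  where
  block : ∀ n → Unique (upBlock n (paths L (h ℕ.+ n)) (lower n m))
  block n with lower n m
  ... | nothing = []
  ... | just m′ = Unique.map⁺ (λ { ≡.refl → ≡.refl }) (paths-unique L (h ℕ.+ n) m′)
  inj : ∀ {x y z} → z ∈ _ → z ∈ _ → x ≡ y
  inj {x} {y} z∈x z∈y
    with _ , ≡.refl ← ∈-upBlock⁻ x (paths L (h ℕ.+ x)) (lower x m) z∈x
       | _ , ≡.refl ← ∈-upBlock⁻ y (paths L (h ℕ.+ y)) (lower y m) z∈y = ≡.refl

module Coefficients {c ℓ} (R : CommutativeRing c ℓ) where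

  open CommutativeRing R
  open PowerSeries R
    hiding (_≈_; _+_; _*_; _^_; 0#; 1#; rawSemiring)
  private module PS = PowerSeries R
  open import Algebra.Properties.CommutativeMonoid.Sum +-commutativeMonoid
    using (sum; sum-cong-≋; sum-replicate-zero; ∑-distrib-+)
  open import Relation.Binary.Reasoning.Setoid setoid

  Coeff : Set c
  Coeff = Exponents → Carrier

  -- Finite sums

  ∑ : (A → Carrier) → List A → Carrier
  ∑ f xs = foldr _+_ 0# (map f xs)

  ∑-cong : {f g : A → Carrier} → (∀ x → f x ≈ g x) → ∀ xs → ∑ f xs ≈ ∑ g xs
  ∑-cong f≈g []       = refl
  ∑-cong f≈g (x ∷ xs) = +-cong (f≈g x) (∑-cong f≈g xs)

  ∑-zero : {f : A → Carrier} → (∀ x → f x ≈ 0#) → ∀ xs → ∑ f xs ≈ 0#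
  ∑-zero f≈0 []       = refl
  ∑-zero f≈0 (x ∷ xs) = trans (+-cong (f≈0 x) (∑-zero f≈0 xs)) (+-identityˡ 0#)

  ∑-++ : ∀ (f : A → Carrier) xs ys → ∑ f (xs ++ ys) ≈ ∑ f xs + ∑ f ys
  ∑-++ f []       ys = sym (+-identityˡ _)
  ∑-++ f (x ∷ xs) ys = trans (+-congˡ (∑-++ f xs ys)) (sym (+-assoc _ _ _))

  ∑-map : ∀ (f : B → Carrier) (g : A → B) xs → ∑ f (map g xs) ≡ ∑ (f ∘ g) xs
  ∑-map f g xs = ≡.cong (foldr _+_ 0#) (≡.sym (map-∘ xs))

  ∑-concatMap : ∀ (f : B → Carrier) (g : A → List B) xs →
                ∑ f (concatMap g xs) ≈ ∑ (λ x → ∑ f (g x)) xs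
  ∑-concatMap f g []       = refl
  ∑-concatMap f g (x ∷ xs) =
    trans (∑-++ f (g x) (concatMap g xs)) (+-congˡ (∑-concatMap f g xs))

  ∑-filter : ∀ {P : Pred A p} (P? : Decidable P) (f : A → Carrier) →
             (∀ x → ¬ P x → f x ≈ 0#) → ∀ xs → ∑ f xs ≈ ∑ f (filter P? xs)
  ∑-filter P? f f≈0 []       = refl
  ∑-filter P? f f≈0 (x ∷ xs) with P? x
  ... | yes _  = +-congˡ (∑-filter P? f f≈0 xs)
  ... | no ¬px = trans (+-congʳ (f≈0 x ¬px)) (trans (+-identityˡ _) (∑-filter P? f f≈0 xs))

  ∑-↭ : ∀ (f : A → Carrier) {xs ys} → xs ↭ ys → ∑ f xs ≈ ∑ f ys
  ∑-↭ f xs↭ys = ↭ₛ.foldr-commMonoid setoid +-isCommutativeMonoid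
    (↭⇒↭ₛ′ isEquivalence (↭.map⁺ f xs↭ys))

  -- Restricting either sum to the common members drops only zero terms, and duplicate-free lists
  -- with the same members are permutations of each other. This compares the unknown index list
  -- supplied by `HasSum` with an explicit one.
  ∑-support : DecidableEquality A → ∀ (f : A → Carrier) {xs ys} →
              Unique xs → Unique ys →
              (∀ x → x ∉ xs → f x ≈ 0#) → (∀ x → x ∉ ys → f x ≈ 0#) →
              ∑ f xs ≈ ∑ f ys
  ∑-support _≟_ f {xs} {ys} xs! ys! off-xs off-ys = begin
    ∑ f xs                  ≈⟨ ∑-filter (_∈? ys) f off-ys xs ⟩
    ∑ f (filter (_∈? ys) xs) ≈⟨ ∑-↭ f (∼bag⇒↭ (unique∧set⇒bag
                                 (Unique.filter⁺ (_∈? ys) xs!) (Unique.filter⁺ (_∈? xs) ys!)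
                                 (mk⇔ (swap-filter xs ys) (swap-filter ys xs)))) ⟩
    ∑ f (filter (_∈? xs) ys) ≈⟨ ∑-filter (_∈? xs) f off-xs ys ⟨
    ∑ f ys                  ∎
    where
    open DecMembership _≟_ using (_∈?_)
    swap-filter : ∀ xs ys {x} → x ∈ filter (_∈? ys) xs → x ∈ filter (_∈? xs) ys
    swap-filter xs ys x∈ with x∈xs , x∈ys ← ∈-filter⁻ (_∈? ys) {xs = xs} x∈ =
      ∈-filter⁺ (_∈? xs) x∈ys x∈xs

  -- Convolution

  -- Agreement is required only at divisors of `m`; this locality lets the uniqueness proof use an
  -- induction hypothesis about smaller monomials.
  convolve-cong : ∀ m {f f′ g g′} →
                  (∀ {a} → a ⊑ m → f a ≈ f′ a) → (∀ {a} → a ⊑ m → g a ≈ g′ a) →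
                  convolve f g m ≈ convolve f′ g′ m
  convolve-cong []      f≈ g≈ = *-cong (f≈ []) (g≈ [])
  convolve-cong (e ∷ m) f≈ g≈ = sum-cong-≋ {suc e} λ i →
    convolve-cong m (λ a⊑m → f≈ (toℕ≤pred[n] i ∷ a⊑m))
                    (λ a⊑m → g≈ (ℕ.m∸n≤m e (toℕ i) ∷ a⊑m))

  convolve-zeroˡ : ∀ {f} g → (∀ a → f a ≈ 0#) → ∀ m → convolve f g m ≈ 0#
  convolve-zeroˡ g f≈0 []      = trans (*-congʳ (f≈0 [])) (zeroˡ _)
  convolve-zeroˡ g f≈0 (e ∷ m) =
    trans (sum-cong-≋ {suc e} λ i → convolve-zeroˡ (g ∘ (e ℕ.∸ toℕ i ∷_)) (λ a → f≈0 (toℕ i ∷ a)) m)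
          (sum-replicate-zero (suc e))

  convolve-zeroʳ : ∀ f {g} → (∀ a → g a ≈ 0#) → ∀ m → convolve f g m ≈ 0#
  convolve-zeroʳ f g≈0 []      = trans (*-congˡ (g≈0 [])) (zeroʳ _)
  convolve-zeroʳ f g≈0 (e ∷ m) =
    trans (sum-cong-≋ {suc e} λ i → convolve-zeroʳ (f ∘ (toℕ i ∷_)) (λ a → g≈0 (e ℕ.∸ toℕ i ∷ a)) m)
          (sum-replicate-zero (suc e))

  convolve-distribʳ : ∀ g f f′ m →
    convolve (λ a → f a + f′ a) g m ≈ convolve f g m + convolve f′ g m
  convolve-distribʳ g f f′ []      = distribʳ _ _ _
  convolve-distribʳ g f f′ (e ∷ m) =
    trans (sum-cong-≋ {suc e} λ i →
             convolve-distribʳ (g ∘ (e ℕ.∸ toℕ i ∷_)) (f ∘ (toℕ i ∷_)) (f′ ∘ (toℕ i ∷_)) m)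
          (∑-distrib-+ {suc e} (λ i → convolve (f ∘ (toℕ i ∷_)) (g ∘ (e ℕ.∸ toℕ i ∷_)) m)
                               (λ i → convolve (f′ ∘ (toℕ i ∷_)) (g ∘ (e ℕ.∸ toℕ i ∷_)) m))

  convolve-∑ˡ : ∀ (F : A → Coeff) g m is →
    convolve (λ a → ∑ (λ i → F i a) is) g m ≈ ∑ (λ i → convolve (F i) g m) is
  convolve-∑ˡ F g m []       = convolve-zeroˡ g (λ _ → refl) m
  convolve-∑ˡ F g m (i ∷ is) =
    trans (convolve-distribʳ g (F i) _ m) (+-congˡ (convolve-∑ˡ F g m is))

  convolve-identityˡ : ∀ f m → convolve oneCoeff f m ≈ f m
  convolve-identityˡ f []      = *-identityˡ _
  convolve-identityˡ f (e ∷ m) = begin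
    convolve oneCoeff (f ∘ (e ∷_)) m + _
      ≈⟨ +-cong (convolve-identityˡ (f ∘ (e ∷_)) m)
                (trans (sum-cong-≋ {e} λ _ → convolve-zeroˡ _ (λ _ → refl) m)
                       (sum-replicate-zero e)) ⟩
    f (e ∷ m) + 0#  ≈⟨ +-identityʳ _ ⟩
    f (e ∷ m)       ∎

  convolve-identityʳ : ∀ f m → convolve f oneCoeff m ≈ f m
  convolve-identityʳ f []          = *-identityʳ _
  convolve-identityʳ f (zero ∷ m)  = trans (+-identityʳ _) (convolve-identityʳ (f ∘ (0 ∷_)) m)
  convolve-identityʳ f (suc e ∷ m) =
    trans (+-cong (convolve-zeroʳ _ (λ _ → refl) m)
                  -- The term `i = 0` vanishes because its second factor has a positive exponent.
                  -- The others form the convolution at `e ∷ m` of `f` with its first exponent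
                  -- raised by one.
                  (convolve-identityʳ (λ { [] → 0# ; (i ∷ a) → f (suc i ∷ a) }) (e ∷ m)))
          (+-identityˡ _)

  -- Multiplication by a variable

  shift : ℕ → Coeff → Coeff
  shift n f m = maybe f 0# (lower n m)

  shift-cong : ∀ n m {f g} → (∀ {a} → lower n m ≡ just a → f a ≈ g a) →
               shift n f m ≈ shift n g m
  shift-cong n m f≈g with lower n m
  ... | nothing = refl
  ... | just _  = f≈g ≡.refl

  shift-suc : ∀ n f e m → shift (suc n) f (e ∷ m) ≡ shift n (f ∘ (e ∷_)) m
  shift-suc n f e m = maybe′-map f 0# (e ∷_) (lower n m)

  shift-∉ : ∀ {n m f} → n ∉ upTo (length m) → shift n f m ≈ 0#
  shift-∉ {n} {m} {f} n∉ = reflexive (≡.cong (maybe f 0#) (lower-∉upTo n m n∉))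

  shift-sum : ∀ {k} n (F : _ → Coeff) m →
              sum {k} (λ i → shift n (F i) m) ≈ shift n (λ a → sum {k} λ i → F i a) m
  shift-sum {k} n F m with lower n m
  ... | nothing = sum-replicate-zero k
  ... | just _  = refl

  -- Associativity t(fg) = (tf)g for a variable t. At the exponent of t, the term `i = 0` vanishes
  -- and the remaining ones are those of the exponent lowered by one.
  convolve-shift : ∀ n f g m → convolve (shift n f) g m ≈ shift n (convolve f g) m
  convolve-shift n       f g []          = zeroˡ _
  convolve-shift zero    f g (zero ∷ m)  =
    trans (+-identityʳ _) (convolve-zeroˡ _ (λ _ → refl) m)
  convolve-shift zero    f g (suc e ∷ m) =
    trans (+-congʳ (convolve-zeroˡ _ (λ _ → refl) m)) (+-identityˡ _)
  convolve-shift (suc n) f g (e ∷ m)     = begin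
    sum {suc e} (λ i → convolve (shift (suc n) f ∘ (toℕ i ∷_)) (g ∘ (e ℕ.∸ toℕ i ∷_)) m)
      ≈⟨ sum-cong-≋ {suc e} (λ i → trans
           (convolve-cong m (λ {a} _ → reflexive (shift-suc n f (toℕ i) a)) (λ _ → refl))
           (convolve-shift n (f ∘ (toℕ i ∷_)) (g ∘ (e ℕ.∸ toℕ i ∷_)) m)) ⟩
    sum {suc e} (λ i → shift n (convolve (f ∘ (toℕ i ∷_)) (g ∘ (e ℕ.∸ toℕ i ∷_))) m)
      ≈⟨ shift-sum {suc e} n (λ i → convolve (f ∘ (toℕ i ∷_)) (g ∘ (e ℕ.∸ toℕ i ∷_))) m ⟩
    shift n (convolve f g ∘ (e ∷_)) m
      ≡⟨ shift-suc n (convolve f g) e m ⟨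
    shift (suc n) (convolve f g) (e ∷ m) ∎

  varCoeff≈shift : ∀ n m → varCoeff n m ≈ shift n oneCoeff m
  varCoeff≈shift zero    []                = refl
  varCoeff≈shift (suc n) []                = refl
  varCoeff≈shift zero    (zero ∷ m)        = refl
  varCoeff≈shift zero    (suc zero ∷ m)    = refl
  varCoeff≈shift zero    (suc (suc _) ∷ m) = refl
  varCoeff≈shift (suc n) (zero ∷ m)        =
    trans (varCoeff≈shift n m) (reflexive (≡.sym (shift-suc n oneCoeff 0 m)))
  varCoeff≈shift (suc n) (suc e ∷ m) with lower n m
  ... | nothing = refl
  ... | just _  = refl

  convolve-varCoeff : ∀ n f m → convolve (varCoeff n) f m ≈ shift n f m
  convolve-varCoeff n f m = begin
    convolve (varCoeff n) f m         ≈⟨ convolve-cong m (λ {a} _ → varCoeff≈shift n a) (λ _ → refl) ⟩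
    convolve (shift n oneCoeff) f m   ≈⟨ convolve-shift n oneCoeff f m ⟩
    shift n (convolve oneCoeff f) m   ≈⟨ shift-cong n m (λ {a} _ → convolve-identityˡ f a) ⟩
    shift n f m                       ∎

  -- The coefficients of Σ_{n ≥ 0} t_{n+1} Fₙ.
  tsum : (ℕ → Coeff) → Coeff
  tsum F m = ∑ (λ n → shift n (F n) m) (upTo (length m))

  tsum-cong : ∀ m {F F′} → (∀ n {a} → lower n m ≡ just a → F n a ≈ F′ n a) →
              tsum F m ≈ tsum F′ m
  tsum-cong m F≈ = ∑-cong (λ n → shift-cong n m (F≈ n)) (upTo (length m))

  tsum-respects : ∀ m {F} → (∀ n {a} → lower n m ≡ just a → F n (a ∷ʳ 0) ≈ F n a) →
                  tsum F (m ∷ʳ 0) ≈ tsum F m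
  tsum-respects m {F} resp = begin
    tsum F (m ∷ʳ 0)
      -- The trailing zero lengthens the index range by one, and the extra term is 0.
      ≈⟨ ∑-support ℕ._≟_ _ (Unique.upTo⁺ _) (Unique.upTo⁺ _)
           (λ n n∉ → shift-∉ {n} {m ∷ʳ 0} n∉)
           (λ n n∉ → trans (shift-∷ʳ n) (shift-∉ {n} {m} n∉)) ⟩
    ∑ (λ n → shift n (F n) (m ∷ʳ 0)) (upTo (length m))
      ≈⟨ ∑-cong shift-∷ʳ (upTo (length m)) ⟩
    tsum F m ∎
    where
    shift-∷ʳ : ∀ n → shift n (F n) (m ∷ʳ 0) ≈ shift n (F n) m
    shift-∷ʳ n rewrite lower-∷ʳ n m with lower n m in eq
    ... | nothing = refl
    ... | just a  = resp n eq

  convolve-tsum : ∀ F g m → convolve (tsum F) g m ≈ tsum (λ n → convolve (F n) g) m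
  convolve-tsum F g m = begin
    convolve (tsum F) g m
      -- The cut-off in `tsum F a` depends on `a`, but a factor of `m` has the same list length, so
      -- one range serves all factors.
      ≈⟨ convolve-cong m (λ {a} a⊑m → reflexive
           (≡.cong (λ k → ∑ (λ n → shift n (F n) a) (upTo k)) (Pointwise-length a⊑m))) (λ _ → refl) ⟩
    convolve (λ a → ∑ (λ n → shift n (F n) a) (upTo (length m))) g m
      ≈⟨ convolve-∑ˡ (λ n → shift n (F n)) g m (upTo (length m)) ⟩
    ∑ (λ n → convolve (shift n (F n)) g m) (upTo (length m))
      ≈⟨ ∑-cong (λ n → convolve-shift n (F n) g m) (upTo (length m)) ⟩
    tsum (λ n → convolve (F n) g) m ∎

  hasSum⇒tsum : ∀ (F : ℕ → Series) r → HasSum U (λ n → t[1+ n ] PS.* F n) r →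
                ∀ m → coeff r m ≈ tsum (coeff ∘ F) m
  hasSum⇒tsum F r r-sum m with is , is! , _ , off , r≈ ← r-sum m = begin
    coeff r m
      ≈⟨ r≈ ⟩
    ∑ (λ n → convolve (varCoeff n) (coeff (F n)) m) is
      ≈⟨ ∑-support ℕ._≟_ _ is! (Unique.upTo⁺ (length m)) (λ n → off n tt)
           (λ n n∉ → trans (convolve-varCoeff n _ m) (shift-∉ {n} {m} n∉)) ⟩
    ∑ (λ n → convolve (varCoeff n) (coeff (F n)) m) (upTo (length m))
      ≈⟨ ∑-cong (λ n → convolve-varCoeff n _ m) (upTo (length m)) ⟩
    tsum (coeff ∘ F) m ∎

  tsum⇒hasSum : ∀ (F : ℕ → Series) r → (∀ m → coeff r m ≈ tsum (coeff ∘ F) m) →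
                HasSum U (λ n → t[1+ n ] PS.* F n) r
  tsum⇒hasSum F r r≈ m =
    upTo (length m) , Unique.upTo⁺ (length m) , All.universal (λ _ → tt) _
    , (λ n _ n∉ → trans (convolve-varCoeff n _ m) (shift-∉ {n} {m} n∉))
    , trans (r≈ m) (sym (∑-cong (λ n → convolve-varCoeff n _ m) (upTo (length m))))

  -- Uniqueness

  pow-cong : ∀ {s s′} n m → (∀ {a} → a ⊑ m → coeff s a ≈ coeff s′ a) →
             coeff (s PS.^ n) m ≈ coeff (s′ PS.^ n) m
  pow-cong zero    m s≈ = refl
  pow-cong (suc n) m s≈ =
    convolve-cong m s≈ (λ {b} b⊑m → pow-cong n b (λ a⊑b → s≈ (⊑-trans a⊑b b⊑m)))

  equation⇒tsum : ∀ {s} → Equation s →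
                  ∀ m → coeff s m ≈ oneCoeff m + tsum (λ n → coeff (s PS.^ suc n)) m
  equation⇒tsum {s} (r , r-sum , s≈) m =
    trans (s≈ m) (+-congˡ (hasSum⇒tsum (λ n → s PS.^ suc n) r r-sum m))

  equation-unique : ∀ {s s′} → Equation s → Equation s′ → s PS.≈ s′
  equation-unique {s} {s′} eq eq′ m = below (suc (size m)) m ℕ.≤-refl
    where
    -- Strong induction on `size m`, with the bound `k` as the structurally decreasing argument.
    below : ∀ k m → size m < k → coeff s m ≈ coeff s′ m
    below (suc k) m (s≤s size≤k) = begin
      coeff s m
        ≈⟨ equation⇒tsum eq m ⟩
      oneCoeff m + tsum (λ n → coeff (s PS.^ suc n)) m
        ≈⟨ +-congˡ (tsum-cong m λ n {a} a≡ → pow-cong {s} {s′} (suc n) a λ {b} b⊑a →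
             -- A divisor `b` of `a` satisfies `size b ≤ size a`, and `a`, being `m` divided by
             -- t_{n+1}, has size smaller than `m` by `1 + n`.
             below k b (ℕ.≤-trans (s≤s (ℕ.≤-trans (sizeFrom-mono 1 b⊑a) (ℕ.m≤n+m (size a) n)))
                       (ℕ.≤-trans (ℕ.≤-reflexive (lower-size 0 n m a≡)) size≤k))) ⟩
      oneCoeff m + tsum (λ n → coeff (s′ PS.^ suc n)) m
        ≈⟨ equation⇒tsum eq′ m ⟨
      coeff s′ m ∎

  -- Generating functions of paths from a given height to 0

  G : ℕ → Coeff
  G h m = ∑ (λ p → coeff (weight p) m) (paths (h ℕ.+ size m) h m)

  -- The contribution of the paths that do not begin with an up step: for positive height those
  -- beginning with `down`, of weight 1, and for height 0 the empty path alone.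
  previous : ℕ → Coeff
  previous zero    = oneCoeff
  previous (suc h) = G h

  ∑-ups : ∀ L h m → h ℕ.+ size m ≡ suc L →
          ∑ (λ p → coeff (weight p) m) (ups L h m) ≈ tsum (λ n → G (h ℕ.+ n)) m
  ∑-ups L h m eq =
    trans (∑-concatMap _ (λ n → upBlock n (paths L (h ℕ.+ n)) (lower n m)) (upTo (length m)))
          (∑-cong block (upTo (length m)))
    where
    block : ∀ n → ∑ (λ p → coeff (weight p) m) (upBlock n (paths L (h ℕ.+ n)) (lower n m))
                  ≈ shift n (G (h ℕ.+ n)) m
    block n with lower n m in lower≡
    ... | nothing = refl
    ... | just a  = begin
      ∑ (λ p → coeff (weight p) m) (map (up n ∷_) (paths L (h ℕ.+ n) a))
        ≡⟨ ∑-map _ (up n ∷_) (paths L (h ℕ.+ n) a) ⟩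
      ∑ (λ p → coeff (weight (up n ∷ p)) m) (paths L (h ℕ.+ n) a)
        ≈⟨ ∑-cong (λ p → trans (convolve-varCoeff n (coeff (weight p)) m)
             (reflexive (≡.cong (maybe (coeff (weight p)) 0#) lower≡))) (paths L (h ℕ.+ n) a) ⟩
      ∑ (λ p → coeff (weight p) a) (paths L (h ℕ.+ n) a)
        -- The remaining length `L` is exactly the length prescribed in `G (h + n)` at `a`.
        ≡⟨ ≡.cong (λ k → ∑ (λ p → coeff (weight p) a) (paths k (h ℕ.+ n) a))
             (ℕ.suc-injective (≡.trans (≡.sym eq) (≡.sym (lower-size h n m lower≡)))) ⟩
      G (h ℕ.+ n) a ∎

  tsum-size-0 : ∀ F m → size m ≡ 0 → tsum F m ≈ 0#
  tsum-size-0 F m size≡0 = ∑-zero vanish (upTo (length m))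
    where
    vanish : ∀ n → shift n (F n) m ≈ 0#
    vanish n with lower n m in eq
    ... | nothing = refl
    ... | just _  with () ← ≡.trans (lower-size 0 n m eq) size≡0

  -- A nonzero size forces a positive exponent. The start index varies because the search moves
  -- along the list.
  oneCoeff-sizeFrom : ∀ k m {L} → sizeFrom (suc k) m ≡ suc L → oneCoeff m ≈ 0#
  oneCoeff-sizeFrom k (zero ∷ m)  eq = oneCoeff-sizeFrom (suc k) m eq
  oneCoeff-sizeFrom k (suc _ ∷ m) eq = refl

  G-rec : ∀ h m → G h m ≈ previous h m + tsum (λ n → G (h ℕ.+ n)) m
  G-rec zero m with size m in eq
  -- Only the empty path is listed, and no variable divides a monomial of size 0.
  ... | zero  = +-congˡ (sym (tsum-size-0 _ m eq))
  -- At height 0 every listed path begins with an up step, and the monomial is not 1.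
  ... | suc L = trans (∑-ups L 0 m eq)
                      (sym (trans (+-congʳ (oneCoeff-sizeFrom 0 m eq)) (+-identityˡ _)))
  G-rec (suc h) m = begin
    G (suc h) m
      ≈⟨ ∑-++ w (map (down ∷_) (paths L h m)) (ups L (suc h) m) ⟩
    ∑ w (map (down ∷_) (paths L h m)) + ∑ w (ups L (suc h) m)
      ≈⟨ +-cong (trans (reflexive (∑-map w (down ∷_) (paths L h m)))
                       (∑-cong (λ p → convolve-identityˡ (coeff (weight p)) m) (paths L h m)))
                (∑-ups L (suc h) m ≡.refl) ⟩
    G h m + tsum (λ n → G (suc h ℕ.+ n)) m ∎
    where
    L = h ℕ.+ size m
    w : Path → Carrier
    w p = coeff (weight p) m

  -- Induction on the path length `h + size m`: both terms of the recursion concern paths with one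
  -- step fewer.
  G-respects : ∀ h → Respects (G h)
  G-respects h m = below (suc (h ℕ.+ size m)) h m ℕ.≤-refl
    where
    below : ∀ k h m → h ℕ.+ size m < k → G h (m ∷ʳ 0) ≈ G h m
    previous-below : ∀ k h m → h ℕ.+ size m ≤ k → previous h (m ∷ʳ 0) ≈ previous h m
    previous-below k zero    m _ = oneCoeff-respects m
    previous-below k (suc h) m ≤k = below k h m ≤k
    below (suc k) h m (s≤s ≤k) = begin
      G h (m ∷ʳ 0)
        ≈⟨ G-rec h (m ∷ʳ 0) ⟩
      previous h (m ∷ʳ 0) + tsum (λ n → G (h ℕ.+ n)) (m ∷ʳ 0)
        ≈⟨ +-cong (previous-below k h m ≤k) (tsum-respects m λ n {a} a≡ →
             below k (h ℕ.+ n) a (ℕ.≤-trans (ℕ.≤-reflexive (lower-size h n m a≡)) ≤k)) ⟩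
      previous h m + tsum (λ n → G (h ℕ.+ n)) m
        ≈⟨ G-rec h m ⟨
      G h m ∎

  -- Combinatorially, a path from `g + h + 1` to 0 splits at its first visit to height `h`: a path
  -- from `g` to 0 raised by `h + 1`, a down step of weight 1, then a path from `h` to 0. The proof
  -- instead fixes `h` and checks that both sides obey the same recursion in `g`.
  G-* : ∀ g h m → convolve (G g) (G h) m ≈ G (suc (g ℕ.+ h)) m
  G-* g h m = below (suc (g ℕ.+ size m)) g m ℕ.≤-refl
    where
    below : ∀ k g m → g ℕ.+ size m < k → convolve (G g) (G h) m ≈ G (suc (g ℕ.+ h)) m
    previous-below : ∀ k g m → g ℕ.+ size m ≤ k → convolve (previous g) (G h) m ≈ G (g ℕ.+ h) m
    -- The convention G(-1) = 1 makes this the unit law.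
    previous-below k zero    m _  = convolve-identityˡ (G h) m
    previous-below k (suc g) m ≤k = below k g m ≤k
    below (suc k) g m (s≤s ≤k) = begin
      convolve (G g) (G h) m
        ≈⟨ convolve-cong m (λ {a} _ → G-rec g a) (λ _ → refl) ⟩
      convolve (λ a → previous g a + tsum (λ n → G (g ℕ.+ n)) a) (G h) m
        ≈⟨ convolve-distribʳ (G h) (previous g) (tsum (λ n → G (g ℕ.+ n))) m ⟩
      convolve (previous g) (G h) m + convolve (tsum (λ n → G (g ℕ.+ n))) (G h) m
        ≈⟨ +-cong (previous-below k g m ≤k) (convolve-tsum (λ n → G (g ℕ.+ n)) (G h) m) ⟩
      G (g ℕ.+ h) m + tsum (λ n → convolve (G (g ℕ.+ n)) (G h)) m
        ≈⟨ +-congˡ (tsum-cong m λ n {a} a≡ → trans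
             (below k (g ℕ.+ n) a (ℕ.≤-trans (ℕ.≤-reflexive (lower-size g n m a≡)) ≤k))
             (reflexive (≡.cong (λ i → G (suc i) a) (+-swap g n h)))) ⟩
      G (g ℕ.+ h) m + tsum (λ n → G (suc (g ℕ.+ h) ℕ.+ n)) m
        ≈⟨ G-rec (suc (g ℕ.+ h)) m ⟨
      G (suc (g ℕ.+ h)) m ∎
      where
      +-swap : ∀ i j k → i ℕ.+ j ℕ.+ k ≡ i ℕ.+ k ℕ.+ j
      +-swap = solve 3 (λ i j k → i :+ j :+ k := i :+ k :+ j) ≡.refl
        where open +-*-Solver

  -- The excursion series

  excursionSeries : Series
  excursionSeries = series (G 0) (G-respects 0)

  G-pow : ∀ n m → coeff (excursionSeries PS.^ suc n) m ≈ G n m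
  G-pow zero    m = convolve-identityʳ (G 0) m
  G-pow (suc n) m = trans (convolve-cong m (λ _ → refl) (λ {a} _ → G-pow n a)) (G-* 0 n m)

  excursionSeries-equation : Equation excursionSeries
  excursionSeries-equation = r , tsum⇒hasSum (λ n → excursionSeries PS.^ suc n) r r≈ , G-rec 0
    where
    r : Series
    -- Building the sum from `G n` instead of the powers makes the equation literally `G-rec 0`.
    r = series (tsum G) (λ m → tsum-respects m λ n {a} _ → G-respects n a)
    r≈ : ∀ m → coeff r m ≈ tsum (λ n → coeff (excursionSeries PS.^ suc n)) m
    r≈ m = tsum-cong m λ n {a} _ → sym (G-pow n a)

  -- Supplies the vanishing condition of `HasSum`. Induction on the path: either its first step is
  -- incompatible with `m`, or the rest is missing from the list for the correspondingly reduced
  -- data.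
  paths-complete : ∀ {h p} → From h p → ∀ L m → h ℕ.+ size m ≡ L →
                   p ∉ paths L h m → coeff (weight p) m ≈ 0#
  paths-complete stop     zero    m eq p∉ = ⊥-elim (p∉ (here ≡.refl))
  paths-complete stop     (suc L) m eq p∉ = oneCoeff-sizeFrom 0 m eq
  paths-complete {suc h} {_ ∷ p} (down q) (suc L) m eq p∉ =
    trans (convolve-identityˡ (coeff (weight p)) m)
          (paths-complete q L m (ℕ.suc-injective eq) (λ p∈ → p∉ (∈-++⁺ˡ (∈-map⁺ (down ∷_) p∈))))
  paths-complete {h} {_ ∷ p} (up n q) L m eq p∉ =
    trans (convolve-varCoeff n (coeff (weight p)) m) (vanish L eq p∉)
    where
    vanish : ∀ L → h ℕ.+ size m ≡ L → up n ∷ p ∉ paths L h m →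
             shift n (coeff (weight p)) m ≈ 0#
    vanish L eq p∉ with lower n m in lower≡
    ... | nothing = refl
    -- A variable dividing `m` makes the length positive.
    vanish zero    eq p∉ | just a with () ← ≡.trans (lower-size h n m lower≡) eq
    vanish (suc L) eq p∉ | just a =
      paths-complete q L a (ℕ.suc-injective (≡.trans (lower-size h n m lower≡) eq)) λ p∈ →
        p∉ (∈-++⁺ʳ (downs L h m) (∈-concatMap⁺ (λ i → upBlock i (paths L (h ℕ.+ i)) (lower i m))
          (lose (∈-upTo⁺ (lower-<length n m lower≡))
                -- The block is known as a mapped list only once `lower n m` is replaced by
                -- `just a`.
                (≡.subst (λ x → up n ∷ p ∈ upBlock n (paths L (h ℕ.+ n)) x) (≡.sym lower≡)
                         (∈-map⁺ (up n ∷_) p∈)))))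

  excursionSeries-generates : ∀ S → S PS.≈ excursionSeries → IsGeneratingFunction IsExcursion S
  excursionSeries-generates S S≈ m =
    paths (size m) 0 m
    , paths-unique (size m) 0 m
    , All.map From⇒IsExcursion (paths-sound (size m) 0 m ≡.refl)
    , (λ p ex → paths-complete (IsExcursion⇒From ex) (size m) m ≡.refl)
    -- The coefficient `G 0 m` is by definition the sum over the list chosen above.
    , S≈ m

theorem3p3 : ∀ {c ℓ} (R : CommutativeRing c ℓ) → let open PowerSeries R in
    ∃! _≈_ Equation × (∀ S → Equation S → IsGeneratingFunction IsExcursion S)
theorem3p3 R =
  (excursionSeries , excursionSeries-equation , equation-unique excursionSeries-equation)
  , λ S eq → excursionSeries-generates S (equation-unique eq excursionSeries-equation)
  where open Coefficients R
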